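{- Let $i,j\geq 3$ be integers with $i\neq 5$ and $j\neq 5$. Then $s_5(P_i\square C_j)=4$.
   Context: $P_k$ denotes the path on $k$ vertices, $C_k$ the cycle on $k$ vertices, and $\square$ denotes the Cartesian product of graphs. A $P_k$-coloring of a graph $G$ is a proper vertex coloring of $G$ in which no copy of $P_k$ in $G$ (as a subgraph, not necessarily induced) is bicolored, i.e. has its vertices colored using only two colors. The $P_k$-chromatic number $s_k(G)$ is the minimum number of colors in a $P_k$-coloring of $G$. -}

module Defs where

open import Data.Nat using (ℕ; suc; _≤_; s≤s)
open import Data.Nat.Properties using (1+n≢n; ≤-antisym)
open import Data.Fin using (Fin; toℕ)
open import Data.Product using (Σ; ∃-syntax; _×_; _,_)
open import Data.Sum using (_⊎_; inj₁; inj₂; swap)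
open import Function.Definitions using (Injective)
open import Relation.Binary using (Rel; Symmetric; Irreflexive)
open import Relation.Binary.PropositionalEquality using (_≡_; _≢_; refl; sym; trans; cong)
open import Relation.Nullary using (¬_)
open import Level using (0ℓ)

record SimpleGraph : Set₁ where
  field
    Vertex     : Set
    Adj        : Rel Vertex 0ℓ
    adj-sym    : Symmetric Adj
    adj-irrefl : Irreflexive _≡_ Adj

open SimpleGraph using (Vertex; Adj; adj-sym; adj-irrefl)

PathAdj : (n : ℕ) → Rel (Fin n) 0ℓ
PathAdj n u v = toℕ v ≡ suc (toℕ u) ⊎ toℕ u ≡ suc (toℕ v)

pathAdj-irrefl : (n : ℕ) → Irreflexive _≡_ (PathAdj n)
pathAdj-irrefl n refl (inj₁ p) = 1+n≢n (sym p)
pathAdj-irrefl n refl (inj₂ p) = 1+n≢n (sym p)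

path : ℕ → SimpleGraph
path n = record
  { Vertex     = Fin n
  ; Adj        = PathAdj n
  ; adj-sym    = swap
  ; adj-irrefl = pathAdj-irrefl n
  }

FirstLast : (n : ℕ) → Rel (Fin n) 0ℓ
FirstLast n u v = toℕ u ≡ 0 × suc (toℕ v) ≡ n

CycleAdj : (n : ℕ) → Rel (Fin n) 0ℓ
CycleAdj n u v = PathAdj n u v ⊎ (FirstLast n u v ⊎ FirstLast n v u)

firstLast-irrefl : (n : ℕ) → 3 ≤ n → (u : Fin n) → ¬ FirstLast n u u
firstLast-irrefl n 3≤n u (p , q) with trans (sym q) (cong suc p)
firstLast-irrefl _ (s≤s ()) u (p , q) | refl

cycle : (n : ℕ) → 3 ≤ n → SimpleGraph
cycle n 3≤n = record
  { Vertex     = Fin n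
  ; Adj        = CycleAdj n
  ; adj-sym    = λ { (inj₁ e) → inj₁ (swap e) ; (inj₂ e) → inj₂ (swap e) }
  ; adj-irrefl = λ
      { p (inj₁ e)           → pathAdj-irrefl n p e
      ; refl (inj₂ (inj₁ e)) → firstLast-irrefl n 3≤n _ e
      ; refl (inj₂ (inj₂ e)) → firstLast-irrefl n 3≤n _ e
      }
  }

infixl 7 _□_

_□_ : SimpleGraph → SimpleGraph → SimpleGraph
G □ H = record
  { Vertex     = Vertex G × Vertex H
  ; Adj        = λ { (g , h) (g′ , h′) →
                     (g ≡ g′ × Adj H h h′) ⊎ (Adj G g g′ × h ≡ h′) }
  ; adj-sym    = λ { (inj₁ (p , e)) → inj₁ (sym p , adj-sym H e)
                   ; (inj₂ (e , p)) → inj₂ (adj-sym G e , sym p) }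
  ; adj-irrefl = λ { refl (inj₁ (_ , e)) → adj-irrefl H refl e
                   ; refl (inj₂ (e , _)) → adj-irrefl G refl e }
  }

-- A copy of H in G as a (not necessarily induced) subgraph.
record Copy (H G : SimpleGraph) : Set where
  field
    embed     : Vertex H → Vertex G
    injective : Injective _≡_ _≡_ embed
    preserves : ∀ {u v} → Adj H u v → Adj G (embed u) (embed v)

Coloring : SimpleGraph → ℕ → Set
Coloring G m = Vertex G → Fin m

Proper : (G : SimpleGraph) {m : ℕ} → Coloring G m → Set
Proper G c = ∀ {u v} → Adj G u v → c u ≢ c v

Bicolored : {G H : SimpleGraph} {m : ℕ} → Coloring G m → Copy H G → Set
Bicolored c P = ∃[ a ] ∃[ b ] ∀ x → c (embed x) ≡ a ⊎ c (embed x) ≡ b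
  where open Copy P

record IsPathColoring (k : ℕ) (G : SimpleGraph) {m : ℕ} (c : Coloring G m) : Set where
  field
    proper       : Proper G c
    no-bicolored : (P : Copy (path k) G) → ¬ Bicolored c P

PathColorable : ℕ → SimpleGraph → ℕ → Set
PathColorable k G m = Σ (Coloring G m) (IsPathColoring k G)

-- "s_k(G) = s" is a relation, since an arbitrary SimpleGraph need not
-- admit a coloring with finitely many colors.
record IsPathChromaticNumber (k : ℕ) (G : SimpleGraph) (s : ℕ) : Set where
  field
    colorable : PathColorable k G s
    minimal   : ∀ m → PathColorable k G m → s ≤ m

pathChromaticNumber-unique : ∀ {k G s t} →
  IsPathChromaticNumber k G s → IsPathChromaticNumber k G t → s ≡ t
pathChromaticNumber-unique p q =
  ≤-antisym (minimal p _ (colorable q)) (minimal q _ (colorable p))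
  where open IsPathChromaticNumber

{-# OPTIONS --safe #-}

-- Upper bound: identify Fin 4 with the group (ℤ/2)², and let a, b colour G and H
-- so that vertices at distance 1 or 2 get distinct colours.  Colour G □ H by
-- a g ⊕ b h.  The colours along a bicolored path alternate, so all its edges have
-- the same colour difference d.  The edges of G of difference d form a matching,
-- and so do those of H; hence the edges of G □ H of difference d have components
-- with at most 4 vertices, too small for a P₅.  A cycle Cₙ has such a colouring
-- with 4 colours as soon as n = 3a + 4b, by concatenating blocks 012 and 0123;
-- among n ≥ 3 only n = 5 is excluded.
--
-- Lower bound: each of the 246 proper colourings of P₃ □ P₃ with colours 0, 1, 2
-- already makes one of seven fixed copies of P₅ bicolored.
module Submission where

open import Defs
open import Data.Fin using (Fin; toℕ; inject≤; remQuot)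
open import Data.Fin.Patterns
open import Data.Fin.Properties
  using (_≟_; all?; any?; toℕ-injective; toℕ-inject≤; inject≤-injective; toℕ<n)
open import Data.List using (List; []; _∷_)
open import Data.List.Membership.Propositional using (find)
open import Data.List.Relation.Unary.All using (All)
import Data.List.Relation.Unary.All as All
open import Data.List.Relation.Unary.Any using (Any)
import Data.List.Relation.Unary.Any as Any
open import Data.Nat using (ℕ; zero; suc; _+_; _≤_; s≤s; s≤s⁻¹)
import Data.Nat.Properties as ℕ
open import Data.Product using (∃-syntax; _×_; _,_; proj₁; proj₂)
open import Data.Product.Properties using (≡-dec)
open import Data.Sum using (_⊎_; inj₁; inj₂)
import Data.Sum as Sum
open import Data.Vec using (Vec; []; _∷_; lookup; tabulate)
open import Data.Vec.Properties using (lookup∘tabulate)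
open import Function using (_∘_; case_of_)
open import Level using (0ℓ)
open import Relation.Binary using (Rel; Decidable; DecidableEquality)
open import Relation.Binary.PropositionalEquality
  using (_≡_; _≢_; refl; sym; trans; cong; cong₂; subst₂; ≢-sym)
open import Relation.Nullary using (¬_; Dec; contradiction; from-yes)
open import Relation.Nullary.Decidable using (map′; _×-dec_; _⊎-dec_; _→-dec_; ¬?)
import Relation.Unary as U

open SimpleGraph using (Vertex; Adj)

-- Arithmetic in (ℤ/2)².

infixl 6 _⊕_

-- abstract, so that unification can solve for the arguments of ⊕
abstract
  _⊕_ : Fin 4 → Fin 4 → Fin 4
  x ⊕ y = lookup (lookup xor x) y
    where
    xor : Vec (Vec (Fin 4) 4) 4
    xor = (0F ∷ 1F ∷ 2F ∷ 3F ∷ [])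
        ∷ (1F ∷ 0F ∷ 3F ∷ 2F ∷ [])
        ∷ (2F ∷ 3F ∷ 0F ∷ 1F ∷ [])
        ∷ (3F ∷ 2F ∷ 1F ∷ 0F ∷ [])
        ∷ []

  ⊕-cancelˡ : ∀ x y z → x ⊕ y ≡ x ⊕ z → y ≡ z
  ⊕-cancelˡ = from-yes (all? λ x → all? λ y → all? λ z →
    (x ⊕ y ≟ x ⊕ z) →-dec (y ≟ z))

  ⊕-cancelʳ : ∀ x y z → y ⊕ x ≡ z ⊕ x → y ≡ z
  ⊕-cancelʳ = from-yes (all? λ x → all? λ y → all? λ z →
    (y ⊕ x ≟ z ⊕ x) →-dec (y ≟ z))

  -- Both equations say that consecutive terms of x, y, z differ by s ⊕ t.
  ⊕-alternateˡ : ∀ x y z s t → x ⊕ s ≡ y ⊕ t → y ⊕ s ≡ z ⊕ t → x ≡ z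
  ⊕-alternateˡ = from-yes (all? λ x → all? λ y → all? λ z → all? λ s → all? λ t →
    (x ⊕ s ≟ y ⊕ t) →-dec ((y ⊕ s ≟ z ⊕ t) →-dec (x ≟ z)))

  ⊕-alternateʳ : ∀ x y z s t → s ⊕ x ≡ t ⊕ y → s ⊕ y ≡ t ⊕ z → x ≡ z
  ⊕-alternateʳ = from-yes (all? λ x → all? λ y → all? λ z → all? λ s → all? λ t →
    (s ⊕ x ≟ t ⊕ y) →-dec ((s ⊕ y ≟ t ⊕ z) →-dec (x ≟ z)))

-- Colourings of the square of a graph, and their sums on products.

record IsSquareColoring (G : SimpleGraph) {m : ℕ} (c : Coloring G m) : Set where
  field
    proper            : Proper G c
    -- The walk `u`, `v`, `w` may turn back, so equal colours yield `u ≡ w` and not a contradiction.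
    locally-injective : ∀ {u v w} → Adj G u v → Adj G v w → c u ≡ c w → u ≡ w

alternates : ∀ {A : Set} {α β x y z : A} → x ≡ α ⊎ x ≡ β → y ≡ α ⊎ y ≡ β → z ≡ α ⊎ z ≡ β →
  x ≢ y → y ≢ z → x ≡ z
alternates (inj₁ refl) _           (inj₁ refl) _   _   = refl
alternates (inj₂ refl) _           (inj₂ refl) _   _   = refl
alternates (inj₁ refl) (inj₁ refl) (inj₂ refl) x≢y _   = contradiction refl x≢y
alternates (inj₁ refl) (inj₂ refl) (inj₂ refl) _   y≢z = contradiction refl y≢z
alternates (inj₂ refl) (inj₂ refl) (inj₁ refl) x≢y _   = contradiction refl x≢y
alternates (inj₂ refl) (inj₁ refl) (inj₁ refl) _   y≢z = contradiction refl y≢z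

module _ {G H : SimpleGraph} {a : Coloring G 4} {b : Coloring H 4}
         (a-sq : IsSquareColoring G a) (b-sq : IsSquareColoring H b) where

  private
    module A = IsSquareColoring a-sq
    module B = IsSquareColoring b-sq

    _~_ : Rel (Vertex (G □ H)) 0ℓ
    _~_ = Adj (G □ H)

  sum : Coloring (G □ H) 4
  sum (g , h) = a g ⊕ b h

  sum-proper : Proper (G □ H) sum
  sum-proper (inj₁ (refl , e)) eq = B.proper e (⊕-cancelˡ _ _ _ eq)
  sum-proper (inj₂ (e , refl)) eq = A.proper e (⊕-cancelʳ _ _ _ eq)

  straight₁ : ∀ {g h h′ h″} → Adj H h h′ → Adj H h′ h″ → sum (g , h) ≡ sum (g , h″) →
    _≡_ {A = Vertex (G □ H)} (g , h) (g , h″)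
  straight₁ e e′ eq = cong (_ ,_) (B.locally-injective e e′ (⊕-cancelˡ _ _ _ eq))

  straight₂ : ∀ {g g′ g″ h} → Adj G g g′ → Adj G g′ g″ → sum (g , h) ≡ sum (g″ , h) →
    _≡_ {A = Vertex (G □ H)} (g , h) (g″ , h)
  straight₂ e e′ eq = cong (_, _) (A.locally-injective e e′ (⊕-cancelʳ _ _ _ eq))

  -- After two consecutive steps in one factor the other summand cancels, so the walk has turned
  -- back. Otherwise the steps alternate between the factors; all colour differences agree, so in
  -- each factor the second step undoes the first and the walk closes up after four steps.
  alternating-degenerate : ∀ {p q r s t} → p ~ q → q ~ r → r ~ s → s ~ t →
    sum p ≡ sum r → sum q ≡ sum s → sum r ≡ sum t →
    p ≡ r ⊎ q ≡ s ⊎ r ≡ t ⊎ p ≡ t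
  alternating-degenerate (inj₁ (refl , e)) (inj₁ (refl , e′)) _ _ pr _ _ =
    inj₁ (straight₁ e e′ pr)
  alternating-degenerate (inj₂ (e , refl)) (inj₂ (e′ , refl)) _ _ pr _ _ =
    inj₁ (straight₂ e e′ pr)
  alternating-degenerate _ (inj₁ (refl , e)) (inj₁ (refl , e′)) _ _ qs _ =
    inj₂ (inj₁ (straight₁ e e′ qs))
  alternating-degenerate _ (inj₂ (e , refl)) (inj₂ (e′ , refl)) _ _ qs _ =
    inj₂ (inj₁ (straight₂ e e′ qs))
  alternating-degenerate _ _ (inj₁ (refl , e)) (inj₁ (refl , e′)) _ _ rt =
    inj₂ (inj₂ (inj₁ (straight₁ e e′ rt)))
  alternating-degenerate _ _ (inj₂ (e , refl)) (inj₂ (e′ , refl)) _ _ rt =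
    inj₂ (inj₂ (inj₁ (straight₂ e e′ rt)))
  alternating-degenerate (inj₁ (refl , e₁)) (inj₂ (e₂ , refl)) (inj₁ (refl , e₃)) (inj₂ (e₄ , refl)) pr qs rt =
    inj₂ (inj₂ (inj₂ (cong₂ _,_
      (A.locally-injective e₂ e₄ (⊕-alternateˡ _ _ _ _ _ qs rt))
      (B.locally-injective e₁ e₃ (⊕-alternateʳ _ _ _ _ _ pr qs)))))
  alternating-degenerate (inj₂ (e₁ , refl)) (inj₁ (refl , e₂)) (inj₂ (e₃ , refl)) (inj₁ (refl , e₄)) pr qs rt =
    inj₂ (inj₂ (inj₂ (cong₂ _,_
      (A.locally-injective e₁ e₃ (⊕-alternateˡ _ _ _ _ _ pr qs))
      (B.locally-injective e₂ e₄ (⊕-alternateʳ _ _ _ _ _ qs rt)))))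

  sum-isPathColoring : IsPathColoring 5 (G □ H) sum
  sum-isPathColoring = record { proper = sum-proper ; no-bicolored = no-bicolored }
    where
    no-bicolored : (P : Copy (path 5) (G □ H)) → ¬ Bicolored sum P
    no-bicolored P (_ , _ , bi) =
      case alternating-degenerate e₀ e₁ e₂ e₃ (alt e₀ e₁) (alt e₁ e₂) (alt e₂ e₃) of λ
        { (inj₁ eq)               → case injective eq of λ ()
        ; (inj₂ (inj₁ eq))        → case injective eq of λ ()
        ; (inj₂ (inj₂ (inj₁ eq))) → case injective eq of λ ()
        ; (inj₂ (inj₂ (inj₂ eq))) → case injective eq of λ ()
        }
      where
      open Copy P
      e₀ : embed 0F ~ embed 1F
      e₀ = preserves (inj₁ refl)
      e₁ : embed 1F ~ embed 2F
      e₁ = preserves (inj₁ refl)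
      e₂ : embed 2F ~ embed 3F
      e₂ = preserves (inj₁ refl)
      e₃ : embed 3F ~ embed 4F
      e₃ = preserves (inj₁ refl)

      alt : ∀ {x y z} → embed x ~ embed y → embed y ~ embed z → sum (embed x) ≡ sum (embed z)
      alt e e′ = alternates (bi _) (bi _) (bi _) (sum-proper e) (sum-proper e′)

-- Square colourings of paths and cycles.

successor⇒squareColoring : ∀ {G m} {c : Coloring G m} (_↝_ : Rel (Vertex G) 0ℓ) →
  (∀ {u v} → Adj G u v → u ↝ v ⊎ v ↝ u) →
  (∀ {u v w} → u ↝ v → u ↝ w → v ≡ w) →
  (∀ {u v w} → u ↝ w → v ↝ w → u ≡ v) →
  (∀ {u v} → u ↝ v → c u ≢ c v) →
  (∀ {u v w} → u ↝ v → v ↝ w → c u ≢ c w) →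
  IsSquareColoring G c
successor⇒squareColoring {G} {c = c} _↝_ orient functional injective proper₁ proper₂ = record
  { proper            = λ e → proper (orient e)
  ; locally-injective = λ e e′ → locally-injective (orient e) (orient e′)
  }
  where
  proper : ∀ {u v} → u ↝ v ⊎ v ↝ u → c u ≢ c v
  proper (inj₁ s) = proper₁ s
  proper (inj₂ s) = ≢-sym (proper₁ s)

  -- A walk that follows the orientation twice, forwards or backwards, has ends of distinct colours.
  -- One that reverses direction at `v` returns to its start, since successors and predecessors are
  -- unique.
  locally-injective : ∀ {u v w} → u ↝ v ⊎ v ↝ u → v ↝ w ⊎ w ↝ v → c u ≡ c w → u ≡ w
  locally-injective (inj₁ s) (inj₁ s′) eq = contradiction eq (proper₂ s s′)
  locally-injective (inj₁ s) (inj₂ s′) eq = injective s s′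
  locally-injective (inj₂ s) (inj₁ s′) eq = functional s s′
  locally-injective (inj₂ s) (inj₂ s′) eq = contradiction (sym eq) (proper₂ s′ s)

IsSquareSequence : (ℕ → Fin 4) → Set
IsSquareSequence s = ∀ k → s k ≢ s (1 + k) × s k ≢ s (2 + k)

infixr 5 _◂_

_◂_ : Fin 4 → (ℕ → Fin 4) → ℕ → Fin 4
(x ◂ s) zero    = x
(x ◂ s) (suc k) = s k

◂-square : ∀ {x s} → x ≢ s 0 → x ≢ s 1 → IsSquareSequence s → IsSquareSequence (x ◂ s)
◂-square x≢s₀ x≢s₁ sq zero    = x≢s₀ , x≢s₁
◂-square x≢s₀ x≢s₁ sq (suc k) = sq k

-- A square sequence starting with 0, 1 and having 0, 1 again at position n; wrapping
-- it around the cycle of length n respects distances 1 and 2.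
record ClosedSequence (n : ℕ) : Set where
  field
    seq     : ℕ → Fin 4
    square  : IsSquareSequence seq
    seq-0   : seq 0 ≡ 0F
    seq-1   : seq 1 ≡ 1F
    seq-n   : seq n ≡ 0F
    seq-1+n : seq (1 + n) ≡ 1F

-- The sequence 012012... is the tail behind all blocks added below; it also colours every path.
closed-0 : ClosedSequence 0
closed-0 = record
  { seq = per ; square = square ; seq-0 = refl ; seq-1 = refl ; seq-n = refl ; seq-1+n = refl }
  where
  per : ℕ → Fin 4
  per 0                   = 0F
  per 1                   = 1F
  per 2                   = 2F
  per (suc (suc (suc k))) = per k

  square : IsSquareSequence per
  square 0                   = (λ ()) , (λ ())
  square 1                   = (λ ()) , (λ ())
  square 2                   = (λ ()) , (λ ())
  square (suc (suc (suc k))) = square k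

-- The block 012 fits in front because the rest starts with 0, 1: the 1 has to differ from that 0,
-- and the 2 from both.
closed-3+ : ∀ {n} → ClosedSequence n → ClosedSequence (3 + n)
closed-3+ c = record
  { seq     = 0F ◂ 1F ◂ 2F ◂ seq
  ; square  = ◂-square (λ ()) (λ ())
             (◂-square (λ ()) (λ p → case trans p seq-0 of λ ())
             (◂-square (λ p → case trans p seq-0 of λ ()) (λ p → case trans p seq-1 of λ ())
              square))
  ; seq-0   = refl
  ; seq-1   = refl
  ; seq-n   = seq-n
  ; seq-1+n = seq-1+n
  }
  where open ClosedSequence c

closed-4+ : ∀ {n} → ClosedSequence n → ClosedSequence (4 + n)
closed-4+ c = record
  { seq     = 0F ◂ 1F ◂ 2F ◂ 3F ◂ seq
  ; square  = ◂-square (λ ()) (λ ())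
             (◂-square (λ ()) (λ ())
             (◂-square (λ ()) (λ p → case trans p seq-0 of λ ())
             (◂-square (λ p → case trans p seq-0 of λ ()) (λ p → case trans p seq-1 of λ ())
              square)))
  ; seq-0   = refl
  ; seq-1   = refl
  ; seq-n   = seq-n
  ; seq-1+n = seq-1+n
  }
  where open ClosedSequence c

-- The sums 6 = 3 + 3, 7 = 3 + 4 and 8 = 4 + 4 represent all residues modulo 3; blocks of length 3
-- reach the rest.
closed-6+ : ∀ n → ClosedSequence (6 + n)
closed-6+ 0                   = closed-3+ (closed-3+ closed-0)
closed-6+ 1                   = closed-3+ (closed-4+ closed-0)
closed-6+ 2                   = closed-4+ (closed-4+ closed-0)
closed-6+ (suc (suc (suc n))) = closed-3+ (closed-6+ n)

closed : ∀ n → 3 ≤ n → n ≢ 5 → ClosedSequence n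
closed 1 (s≤s ())
closed 2 (s≤s (s≤s ()))
closed 3 _ _   = closed-3+ closed-0
closed 4 _ _   = closed-4+ closed-0
closed 5 _ n≢5 = contradiction refl n≢5
closed (suc (suc (suc (suc (suc (suc n)))))) _ _ = closed-6+ n

path-squareColoring : ∀ n → ∃[ c ] IsSquareColoring (path n) {4} c
path-squareColoring n = seq ∘ toℕ , successor⇒squareColoring
  (λ u v → toℕ v ≡ suc (toℕ u))
  (λ e → e)
  (λ p q → toℕ-injective (trans p (sym q)))
  (λ p q → toℕ-injective (ℕ.suc-injective (trans (sym p) q)))
  (λ {u} p eq → proj₁ (square (toℕ u)) (trans eq (cong seq p)))
  (λ {u} p q eq → proj₂ (square (toℕ u)) (trans eq (cong seq (trans q (cong suc p)))))
  where open ClosedSequence closed-0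

cycle-squareColoring : ∀ n (3≤n : 3 ≤ n) → ClosedSequence n →
  ∃[ c ] IsSquareColoring (cycle n 3≤n) {4} c
cycle-squareColoring n 3≤n cl = color , successor⇒squareColoring
  _↝_ orient functional injective
  (λ {u} s eq → proj₁ (square (toℕ u)) (trans eq (color-next s)))
  (λ {u} s s′ eq → proj₂ (square (toℕ u)) (trans eq (color-next² s s′)))
  where
  open ClosedSequence cl

  color : Fin n → Fin 4
  color = seq ∘ toℕ

  _↝_ : Rel (Fin n) 0ℓ
  -- In `FirstLast n v u` the vertex `v` is the first and `u` the last, so the closing edge leads
  -- from the end back to 0.
  u ↝ v = toℕ v ≡ suc (toℕ u) ⊎ FirstLast n v u

  orient : ∀ {u v} → CycleAdj n u v → u ↝ v ⊎ v ↝ u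
  orient (inj₁ (inj₁ e)) = inj₁ (inj₁ e)
  orient (inj₁ (inj₂ e)) = inj₂ (inj₁ e)
  orient (inj₂ (inj₁ e)) = inj₂ (inj₂ e)
  orient (inj₂ (inj₂ e)) = inj₁ (inj₂ e)

  functional : ∀ {u v w} → u ↝ v → u ↝ w → v ≡ w
  functional (inj₁ p)       (inj₁ q)       = toℕ-injective (trans p (sym q))
  functional (inj₂ (p , _)) (inj₂ (q , _)) = toℕ-injective (trans p (sym q))
  functional {v = v} (inj₁ p) (inj₂ (_ , q)) = contradiction (trans p q) (ℕ.<⇒≢ (toℕ<n v))
  functional {w = w} (inj₂ (_ , p)) (inj₁ q) = contradiction (trans q p) (ℕ.<⇒≢ (toℕ<n w))

  injective : ∀ {u v w} → u ↝ w → v ↝ w → u ≡ v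
  injective (inj₁ p)       (inj₁ q)       = toℕ-injective (ℕ.suc-injective (trans (sym p) q))
  injective (inj₂ (_ , p)) (inj₂ (_ , q)) = toℕ-injective (ℕ.suc-injective (trans p (sym q)))
  injective (inj₁ p)       (inj₂ (q , _)) = contradiction (trans (sym q) p) λ ()
  injective (inj₂ (p , _)) (inj₁ q)       = contradiction (trans (sym p) q) λ ()

  -- Positions `n` and `1 + n` of the sequence repeat positions 0 and 1, so one or two steps across
  -- the closing edge can be read off as steps along the sequence.
  color-next : ∀ {u v} → u ↝ v → color v ≡ seq (1 + toℕ u)
  color-next (inj₁ p)                     = cong seq p
  color-next (inj₂ (p , q)) rewrite p | q = trans seq-0 (sym seq-n)

  color-next² : ∀ {u v w} → u ↝ v → v ↝ w → color w ≡ seq (2 + toℕ u)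
  color-next² (inj₁ p)       s = trans (color-next s) (cong (seq ∘ suc) p)
  color-next² (inj₂ (p , q)) s =
    trans (color-next s) (trans (cong (seq ∘ suc) p)
      (trans seq-1 (sym (trans (cong (seq ∘ suc) q) seq-1+n))))

-- Copies of paths, cycles and products in one another.

_⊚_ : ∀ {G H K} → Copy H K → Copy G H → Copy G K
P ⊚ Q = record
  { embed     = P.embed ∘ Q.embed
  ; injective = Q.injective ∘ P.injective
  ; preserves = P.preserves ∘ Q.preserves
  }
  where
  module P = Copy P
  module Q = Copy Q

□-copy : ∀ {G G′ H H′} → Copy G G′ → Copy H H′ → Copy (G □ H) (G′ □ H′)
□-copy {G} {G′} {H} {H′} P Q = record
  { embed     = λ { (g , h) → P.embed g , Q.embed h }
  ; injective = λ eq → cong₂ _,_ (P.injective (cong proj₁ eq)) (Q.injective (cong proj₂ eq))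
  ; preserves = preserves
  }
  where
  module P = Copy P
  module Q = Copy Q

  preserves : ∀ {u v} → Adj (G □ H) u v →
    Adj (G′ □ H′) (P.embed (proj₁ u) , Q.embed (proj₂ u)) (P.embed (proj₁ v) , Q.embed (proj₂ v))
  preserves (inj₁ (p , e)) = inj₁ (cong P.embed p , Q.preserves e)
  preserves (inj₂ (e , p)) = inj₂ (P.preserves e , cong Q.embed p)

path-copy : ∀ {m n} → m ≤ n → Copy (path m) (path n)
path-copy {m} {n} m≤n = record
  { embed     = λ u → inject≤ u m≤n
  ; injective = inject≤-injective m≤n m≤n _ _
  ; preserves = Sum.map step step
  }
  where
  step : ∀ {u v : Fin m} → toℕ v ≡ suc (toℕ u) → toℕ (inject≤ v m≤n) ≡ suc (toℕ (inject≤ u m≤n))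
  step {u} {v} p rewrite toℕ-inject≤ u m≤n | toℕ-inject≤ v m≤n = p

path-copy-cycle : ∀ n (3≤n : 3 ≤ n) → Copy (path n) (cycle n 3≤n)
path-copy-cycle n _ = record { embed = λ u → u ; injective = λ p → p ; preserves = inj₁ }

-- Exhaustive check on the 3 by 3 grid, and the lower bound.

grid : SimpleGraph
grid = path 3 □ path 3

cell : Fin 9 → Vertex grid
cell = remQuot 3

Walk : Set
Walk = Vec (Fin 9) 5

pathAdj? : ∀ {n} → Decidable (PathAdj n)
pathAdj? u v = (toℕ v ℕ.≟ suc (toℕ u)) ⊎-dec (toℕ u ℕ.≟ suc (toℕ v))

gridAdj? : Decidable (Adj grid)
gridAdj? (g , h) (g′ , h′) = ((g ≟ g′) ×-dec pathAdj? h h′) ⊎-dec (pathAdj? g g′ ×-dec (h ≟ h′))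

-- The conditions of `Copy` with explicit quantifiers over `Fin 5`, in a form that a finite check
-- decides.
IsCopy : Walk → Set
IsCopy w = (∀ x y → cell (lookup w x) ≡ cell (lookup w y) → x ≡ y) ×
           (∀ x y → PathAdj 5 x y → Adj grid (cell (lookup w x)) (cell (lookup w y)))

toCopy : ∀ w → IsCopy w → Copy (path 5) grid
toCopy w (injective , preserves) = record
  { embed     = cell ∘ lookup w
  ; injective = injective _ _
  ; preserves = preserves _ _
  }

isCopy? : U.Decidable IsCopy
isCopy? w =
  (all? λ x → all? λ y → (cell (lookup w x) ≟² cell (lookup w y)) →-dec (x ≟ y)) ×-dec
  (all? λ x → all? λ y → pathAdj? x y →-dec gridAdj? (cell (lookup w x)) (cell (lookup w y)))
  where
  _≟²_ : DecidableEquality (Vertex grid)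
  _≟²_ = ≡-dec _≟_ _≟_

-- A family sufficient for twoColoring?, found by computer search.  Cells are numbered row by row.
walks : List Walk
walks =
    (0F ∷ 1F ∷ 4F ∷ 5F ∷ 8F ∷ [])
  ∷ (1F ∷ 2F ∷ 5F ∷ 8F ∷ 7F ∷ [])
  ∷ (2F ∷ 1F ∷ 4F ∷ 7F ∷ 8F ∷ [])
  ∷ (3F ∷ 4F ∷ 7F ∷ 8F ∷ 5F ∷ [])
  ∷ (3F ∷ 6F ∷ 7F ∷ 8F ∷ 5F ∷ [])
  ∷ (6F ∷ 3F ∷ 4F ∷ 5F ∷ 8F ∷ [])
  ∷ (6F ∷ 7F ∷ 4F ∷ 5F ∷ 2F ∷ [])
  ∷ []

walks-are-copies : All IsCopy walks
walks-are-copies = from-yes (All.all? isCopy? walks)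

edges : List (Fin 9 × Fin 9)
edges =
    (0F , 1F) ∷ (1F , 2F) ∷ (3F , 4F) ∷ (4F , 5F) ∷ (6F , 7F) ∷ (7F , 8F)
  ∷ (0F , 3F) ∷ (3F , 6F) ∷ (1F , 4F) ∷ (4F , 7F) ∷ (2F , 5F) ∷ (5F , 8F)
  ∷ []

edges-are-adjacent : All (λ (x , y) → Adj grid (cell x) (cell y)) edges
edges-are-adjacent = from-yes (All.all? (λ (x , y) → gridAdj? (cell x) (cell y)) edges)

Separated : ∀ {m} → Vec (Fin m) 9 → Set
Separated v = All (λ (x , y) → lookup v x ≢ lookup v y) edges

separated? : ∀ {m} → U.Decidable (Separated {m})
separated? v = All.all? (λ (x , y) → ¬? (lookup v x ≟ lookup v y)) edges

-- One of the two colours may be taken to be that of the first vertex, which leaves only `b` to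
-- search for.
TwoColored : ∀ {m} → Vec (Fin m) 9 → Walk → Set
TwoColored {m} v w = ∃[ b ] ∀ x → color x ≡ color 0F ⊎ color x ≡ b
  where
  color : Fin 5 → Fin m
  color x = lookup v (lookup w x)

twoColored? : ∀ {m} (v : Vec (Fin m) 9) → U.Decidable (TwoColored v)
twoColored? v w = any? λ b → all? λ x → (_ ≟ _) ⊎-dec (_ ≟ b)

-- Vectors stand in for colourings here: a predicate on functions need not respect pointwise
-- equality.
∀-vec? : ∀ {m n} {P : Vec (Fin m) n → Set} → U.Decidable P → Dec (∀ v → P v)
∀-vec? {n = zero}  P? = map′ (λ { p [] → p }) (λ f → f []) (P? [])
∀-vec? {n = suc n} P? = map′ (λ { f (x ∷ v) → f x v }) (λ f x v → f (x ∷ v))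
  (all? λ x → ∀-vec? λ v → P? (x ∷ v))

TwoColoring : ∀ {m} → Vec (Fin m) 9 → Set
TwoColoring v = Separated v → Any (TwoColored v) walks

-- A search through all m^9 vectors, hence 3^9 = 19683 for three colours.
twoColoring? : ∀ m → Dec (∀ v → TwoColoring {m} v)
twoColoring? m = ∀-vec? λ v → separated? v →-dec Any.any? (twoColored? v) walks

-- abstract, since unfolding the exhaustive check in later types is prohibitively slow
abstract
  grid-two-colored : ∀ m → m ≤ 3 → (v : Vec (Fin m) 9) → TwoColoring v
  grid-two-colored 0 _ = from-yes (twoColoring? 0)
  grid-two-colored 1 _ = from-yes (twoColoring? 1)
  grid-two-colored 2 _ = from-yes (twoColoring? 2)
  grid-two-colored 3 _ = from-yes (twoColoring? 3)
  grid-two-colored (suc (suc (suc (suc _)))) (s≤s (s≤s (s≤s ())))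

grid-bicolored : ∀ {m} → m ≤ 3 → (c : Coloring grid m) → Proper grid c →
  ∃[ P ] Bicolored {H = path 5} c P
grid-bicolored {m} m≤3 c proper =
  let w , w∈walks , b , two = find (grid-two-colored m m≤3 v separated)
  -- The omitted first colour is `c (cell (lookup w 0F))`; `color` carries the result from `v` back
  -- to `c`.
  in toCopy w (All.lookup walks-are-copies w∈walks) , _ , b , λ x →
     subst₂ (λ y z → y ≡ z ⊎ y ≡ b) (color (lookup w x)) (color (lookup w 0F)) (two x)
  where
  v : Vec (Fin m) 9
  v = tabulate (c ∘ cell)

  color : ∀ k → lookup v k ≡ c (cell k)
  color = lookup∘tabulate (c ∘ cell)

  separated : Separated v
  separated = All.map
    (λ {(x , y)} e → subst₂ _≢_ (sym (color x)) (sym (color y)) (proper e))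
    edges-are-adjacent

-- A colouring of `G` with at most three colours would restrict to a proper one of `grid`, and the
-- bicolored path found there is also one in `G`.
grid⇒4≤ : ∀ {G} → Copy grid G → ∀ m → PathColorable 5 G m → 4 ≤ m
grid⇒4≤ Q m (c , isColoring) = ℕ.≮⇒≥ λ m<4 →
  let P , bi = grid-bicolored (s≤s⁻¹ m<4) (c ∘ embed) (proper ∘ preserves)
  in no-bicolored (Q ⊚ P) bi
  where
  open Copy Q
  open IsPathColoring isColoring

corollary11 : ∀ (i j : ℕ) → 3 ≤ i → (3≤j : 3 ≤ j) → i ≢ 5 → j ≢ 5 →
    IsPathChromaticNumber 5 (path i □ cycle j 3≤j) 4
corollary11 i j 3≤i 3≤j _ j≢5 = record
  { colorable = _ , sum-isPathColoring
      (proj₂ (path-squareColoring i)) (proj₂ (cycle-squareColoring j 3≤j (closed j 3≤j j≢5)))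
  -- The grid occupies the first three vertices of each factor; in the cycle these are reached
  -- through the spanning path.
  ; minimal   = grid⇒4≤ (□-copy (path-copy 3≤i) (path-copy-cycle j 3≤j ⊚ path-copy 3≤j))
  }
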